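{- (Existence of solutions.) Every well-nested $G$-coalgebra admits a solution.
   Context: Syntax. Fix disjoint nonempty sets $\Sigma$ (actions) and $T=\{t_1,\dots,t_n\}$ (primitive tests), $T$ finite. Boolean expressions $b,c\in\mathrm{BExp}$ are generated by $0 \mid 1 \mid t\in T \mid b\cdot c \mid b+c \mid \overline{b}$. GKAT expressions $e,f,g\in\mathrm{Exp}$ are generated by $p\in\Sigma \mid b\in\mathrm{BExp} \mid e\cdot f \mid e+_b f \mid e^{(b)}$; $ef$ abbreviates $e\cdot f$. $\equiv_{BA}$ denotes Boolean equivalence, $b\le c$ iff $b+c\equiv_{BA}c$. $\mathrm{At}$ is the finite set of atoms (minimal nonzero elements) of the free Boolean algebra $\mathrm{BExp}/{\equiv_{BA}}$ on $T$; an atom is also used as a Boolean expression via a representative $c_1\cdots c_n$ with $c_i\in\{t_i,\overline{t_i}\}$. Axioms. $E:\mathrm{Exp}\to\mathrm{BExp}$ is defined by $E(b)=b$, $E(p)=0$, $E(e+_bf)=b\cdot E(e)+\overline{b}\cdot E(f)$, $E(e\cdot f)=E(e)\cdot E(f)$, $E(e^{(b)})=\overline{b}$. The relation $\equiv$ is the smallest congruence (with respect to all operators) on $\mathrm{Exp}$ such that $b\equiv_{BA}c$ implies $b\equiv c$ and, for all $e,f,g\in\mathrm{Exp}$, $b,c\in\mathrm{BExp}$: (U1) $e+_be\equiv e$; (U2) $e+_bf\equiv f+_{\overline{b}}e$; (U3) $(e+_bf)+_cg\equiv e+_{bc}(f+_cg)$; (U4) $e+_bf\equiv be+_bf$; (U5)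 $eg+_bfg\equiv(e+_bf)\cdot g$; (S1) $(e\cdot f)\cdot g\equiv e\cdot(f\cdot g)$; (S2) $0\cdot e\equiv0$; (S3) $e\cdot0\equiv0$; (S4) $1\cdot e\equiv e$; (S5) $e\cdot1\equiv e$; (W1) $e^{(b)}\equiv ee^{(b)}+_b1$; (W2) $(e+_c1)^{(b)}\equiv(ce)^{(b)}$; (W3) if $g\equiv eg+_bf$ and $E(e)\equiv0$, then $g\equiv e^{(b)}f$. Guarded sums. For $\Phi\subseteq\mathrm{At}$ and expressions $(e_\alpha)_{\alpha\in\Phi}$: $\bigoplus_{\alpha\in\emptyset}e_\alpha=0$ and, for any choice of $\beta\in\Phi$, $\bigoplus_{\alpha\in\Phi}e_\alpha=e_\beta+_\beta\bigl(\bigoplus_{\alpha\in\Phi\setminus\{\beta\}}e_\alpha\bigr)$ (the choice of $\beta$ is immaterial up to $\equiv$). Coalgebras. Let $GX=(2+\Sigma\times X)^{\mathrm{At}}$ with $2=\{0,1\}$. A $G$-coalgebra is a pair $\mathcal{X}=\langle X,\delta^{\mathcal{X}}\rangle$ with $\delta^{\mathcal{X}}:X\to GX$. The coproduct $\mathcal{X}+\mathcal{Y}$ has the disjoint union $X+Y$ as states, with $\delta^{\mathcal{X}}$ on $X$ and $\delta^{\mathcal{Y}}$ on $Y$. For $Y\subseteq X$ and $h\in GX$, the uniform continuation $\mathcal{X}[Y,h]=\langle X,\delta[Y,h]\rangle$ is given by $\delta[Y,h](x)(\alpha)=h(\alpha)$ if $x\in Y$ and $\delta^{\mathcal{X}}(x)(\alpha)=1$,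 and $\delta^{\mathcal{X}}(x)(\alpha)$ otherwise. Well-nested coalgebras are defined inductively: (i) if $\mathcal{X}$ has no transitions, i.e. $\delta^{\mathcal{X}}(x)(\alpha)\in2$ for all $x,\alpha$, then $\mathcal{X}$ is well-nested; (ii) if $\mathcal{X}$ and $\mathcal{Y}$ are well-nested and $h\in G(X+Y)$, then $(\mathcal{X}+\mathcal{Y})[X,h]$ is well-nested. Solutions. A map $s:X\to\mathrm{Exp}$ is a solution to $\mathcal{X}$ if for all $x\in X$, $s(x)\equiv\bigoplus_{\alpha\in\mathrm{At}}\lfloor\delta^{\mathcal{X}}(x)(\alpha)\rfloor_s$, where $\lfloor0\rfloor_s=0$, $\lfloor1\rfloor_s=1$, $\lfloor(p,x')\rfloor_s=p\cdot s(x')$. -}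

module Defs where

open import Level using (Level; _⊔_) renaming (suc to lsuc)
open import Algebra.Lattice.Bundles using (BooleanAlgebra)
import Algebra.Lattice.Properties.BooleanAlgebra as BAProperties
open import Data.Bool.Base using (Bool; true; false; not; _∧_; _∨_; if_then_else_)
import Data.Bool.Properties as Bool
open import Data.Empty using (⊥-elim)
open import Data.Fin.Base using (Fin; zero; suc)
open import Data.List.Base as List using (List; []; _∷_; _++_; foldr)
import Data.List.Properties as List
open import Data.List.Membership.Propositional using (_∈_)
open import Data.List.Membership.Propositional.Properties using (∈-map⁺; ∈-map⁻; ∈-++⁺ˡ; ∈-++⁺ʳ)
open import Data.List.Relation.Unary.Any using (here; there)
open import Data.List.Relation.Unary.All using ([])
open import Data.List.Relation.Unary.AllPairs using ([]; _∷_)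
open import Data.List.Relation.Unary.Unique.Propositional using (Unique)
import Data.List.Relation.Unary.Unique.Propositional.Properties as Unique
open import Data.Nat.Base using (ℕ; zero; suc)
open import Data.Product.Base using (∃; _×_; _,_; map₂)
open import Data.Sum.Base using (_⊎_; inj₁; inj₂; [_,_])
import Data.Sum.Base as Sum
open import Data.Vec.Base using (Vec; []; _∷_; lookup)
import Data.Vec.Properties as Vec
open import Function.Base using (_∘_; id; const)
open import Relation.Nullary using (¬_)
open import Relation.Binary.PropositionalEquality as ≡ using (_≡_; refl)
import Relation.Binary.Reasoning.Setoid as SetoidReasoning

infixr 7 _·ᵇ_
infixr 6 _+ᵇ_
infix  8 _ᶜ
infix  4 _≡BA_ _≤BA_

data BExp (n : ℕ) : Set where
  𝟘 𝟙       : BExp n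
  prim      : Fin n → BExp n
  _·ᵇ_ _+ᵇ_ : BExp n → BExp n → BExp n
  _ᶜ        : BExp n → BExp n

-- Equational theory of Boolean algebras: `BExp n` modulo `_≡BA_` is the
-- free Boolean algebra on n generators (see `freeBA`).  The remaining
-- distributive, unit and complement laws follow from those listed.
data _≡BA_ {n : ℕ} : BExp n → BExp n → Set where
  ba-refl  : ∀ {b} → b ≡BA b
  ba-sym   : ∀ {b c} → b ≡BA c → c ≡BA b
  ba-trans : ∀ {b c d} → b ≡BA c → c ≡BA d → b ≡BA d

  ·ᵇ-cong : ∀ {b b′ c c′} → b ≡BA b′ → c ≡BA c′ → b ·ᵇ c ≡BA b′ ·ᵇ c′
  +ᵇ-cong : ∀ {b b′ c c′} → b ≡BA b′ → c ≡BA c′ → b +ᵇ c ≡BA b′ +ᵇ c′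
  ᶜ-cong  : ∀ {b b′} → b ≡BA b′ → b ᶜ ≡BA b′ ᶜ

  ·ᵇ-comm : ∀ b c → b ·ᵇ c ≡BA c ·ᵇ b
  +ᵇ-comm : ∀ b c → b +ᵇ c ≡BA c +ᵇ b

  ·ᵇ-assoc : ∀ b c d → (b ·ᵇ c) ·ᵇ d ≡BA b ·ᵇ (c ·ᵇ d)
  +ᵇ-assoc : ∀ b c d → (b +ᵇ c) +ᵇ d ≡BA b +ᵇ (c +ᵇ d)

  ·ᵇ-absorbs-+ᵇ : ∀ b c → b ·ᵇ (b +ᵇ c) ≡BA b
  +ᵇ-absorbs-·ᵇ : ∀ b c → b +ᵇ (b ·ᵇ c) ≡BA b

  +ᵇ-distribʳ-·ᵇ : ∀ b c d → (c ·ᵇ d) +ᵇ b ≡BA (c +ᵇ b) ·ᵇ (d +ᵇ b)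

  ·ᵇ-complement : ∀ b → b ·ᵇ b ᶜ ≡BA 𝟘
  +ᵇ-complement : ∀ b → b +ᵇ b ᶜ ≡BA 𝟙

_≤BA_ : ∀ {n} → BExp n → BExp n → Set
b ≤BA c = b +ᵇ c ≡BA c

freeBA : ℕ → BooleanAlgebra _ _
freeBA n = record
  { Carrier = BExp n
  ; _≈_ = _≡BA_
  ; _∨_ = _+ᵇ_
  ; _∧_ = _·ᵇ_
  ; ¬_  = _ᶜ
  ; ⊤   = 𝟙
  ; ⊥   = 𝟘
  ; isBooleanAlgebra = isBooleanAlgebraʳ record
    { isDistributiveLattice = isDistributiveLatticeʳʲᵐ record
      { isLattice = record
        { isEquivalence = record { refl = ba-refl ; sym = ba-sym ; trans = ba-trans }
        ; ∨-comm  = +ᵇ-comm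
        ; ∨-assoc = +ᵇ-assoc
        ; ∨-cong  = +ᵇ-cong
        ; ∧-comm  = ·ᵇ-comm
        ; ∧-assoc = ·ᵇ-assoc
        ; ∧-cong  = ·ᵇ-cong
        ; absorptive = +ᵇ-absorbs-·ᵇ , ·ᵇ-absorbs-+ᵇ
        }
      ; ∨-distribʳ-∧ = +ᵇ-distribʳ-·ᵇ
      }
    ; ∨-complementʳ = +ᵇ-complement
    ; ∧-complementʳ = ·ᵇ-complement
    ; ¬-cong        = ᶜ-cong
    }
  }
  where open import Algebra.Lattice.Structures.Biased (_≡BA_ {n})

-- An atom is given by its representative c₁⋯cₙ: entry i is `true` when
-- cᵢ = tᵢ and `false` when cᵢ is the complement of tᵢ.  The lemmas
-- `⌜⌝-isAtom`, `⌜⌝-injective` and `isAtom⇒⌜⌝` below show that this is a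
-- bijective enumeration of the minimal nonzero elements of `freeBA n`.
At : ℕ → Set
At n = Vec Bool n

literal : ∀ {n} → Bool → Fin n → BExp n
literal true  i = prim i
literal false i = prim i ᶜ

conj : ∀ {n} → List (BExp n) → BExp n
conj = foldr _·ᵇ_ 𝟙

⌜_⌝ : ∀ {n} → At n → BExp n
⌜ α ⌝ = conj (List.tabulate λ i → literal (lookup α i) i)

atoms : ∀ n → List (At n)
atoms zero    = [] ∷ []
atoms (suc n) = List.map (true ∷_) (atoms n) ++ List.map (false ∷_) (atoms n)

atoms-complete : ∀ {n} (α : At n) → α ∈ atoms n
atoms-complete []          = here refl
atoms-complete (true ∷ α)  = ∈-++⁺ˡ (∈-map⁺ _ (atoms-complete α))
atoms-complete (false ∷ α) = ∈-++⁺ʳ _ (∈-map⁺ _ (atoms-complete α))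

atoms-unique : ∀ n → Unique (atoms n)
atoms-unique zero    = [] ∷ []
atoms-unique (suc n) =
  Unique.++⁺ (Unique.map⁺ Vec.∷-injectiveʳ (atoms-unique n))
             (Unique.map⁺ Vec.∷-injectiveʳ (atoms-unique n))
             λ (p , q) → disjoint p q
  where
  disjoint : ∀ {v} → v ∈ List.map (true ∷_) (atoms n) →
             ¬ (v ∈ List.map (false ∷_) (atoms n))
  disjoint p q with ∈-map⁻ _ p | ∈-map⁻ _ q
  ... | _ , _ , refl | _ , _ , ()

IsAtom : ∀ {n} → BExp n → Set
IsAtom {n} b = ¬ (b ≡BA 𝟘) × (∀ (c : BExp n) → c ≤BA b → c ≡BA 𝟘 ⊎ c ≡BA b)

eval : ∀ {n} → At n → BExp n → Bool
eval α 𝟘        = false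
eval α 𝟙        = true
eval α (prim i) = lookup α i
eval α (b ·ᵇ c) = eval α b ∧ eval α c
eval α (b +ᵇ c) = eval α b ∨ eval α c
eval α (b ᶜ)    = not (eval α b)

eval-sound : ∀ {n} (α : At n) {b c} → b ≡BA c → eval α b ≡ eval α c
eval-sound α ba-refl = refl
eval-sound α (ba-sym p) = ≡.sym (eval-sound α p)
eval-sound α (ba-trans p q) = ≡.trans (eval-sound α p) (eval-sound α q)
eval-sound α (·ᵇ-cong p q) = ≡.cong₂ _∧_ (eval-sound α p) (eval-sound α q)
eval-sound α (+ᵇ-cong p q) = ≡.cong₂ _∨_ (eval-sound α p) (eval-sound α q)
eval-sound α (ᶜ-cong p) = ≡.cong not (eval-sound α p)
eval-sound α (·ᵇ-comm b c) = Bool.∧-comm (eval α b) (eval α c)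
eval-sound α (+ᵇ-comm b c) = Bool.∨-comm (eval α b) (eval α c)
eval-sound α (·ᵇ-assoc b c d) = Bool.∧-assoc (eval α b) (eval α c) (eval α d)
eval-sound α (+ᵇ-assoc b c d) = Bool.∨-assoc (eval α b) (eval α c) (eval α d)
eval-sound α (·ᵇ-absorbs-+ᵇ b c) = Bool.∧-abs-∨ (eval α b) (eval α c)
eval-sound α (+ᵇ-absorbs-·ᵇ b c) = Bool.∨-abs-∧ (eval α b) (eval α c)
eval-sound α (+ᵇ-distribʳ-·ᵇ b c d) =
  Bool.∨-distribʳ-∧ (eval α b) (eval α c) (eval α d)
eval-sound α (·ᵇ-complement b) = Bool.∧-inverseʳ (eval α b)
eval-sound α (+ᵇ-complement b) = Bool.∨-inverseʳ (eval α b)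

eval-literal : ∀ {n} (α : At n) i → eval α (literal (lookup α i) i) ≡ true
eval-literal α i with lookup α i in eq
... | true  = eq
... | false = ≡.cong not eq

eval-conj : ∀ {n k} (α : At n) (f : Fin k → BExp n) →
            (∀ i → eval α (f i) ≡ true) → eval α (conj (List.tabulate f)) ≡ true
eval-conj {k = zero}  α f h = refl
eval-conj {k = suc k} α f h rewrite h zero = eval-conj α (f ∘ suc) (h ∘ suc)

eval-⌜⌝ : ∀ {n} (α : At n) → eval α ⌜ α ⌝ ≡ true
eval-⌜⌝ α = eval-conj α _ (eval-literal α)

module _ {n : ℕ} where
  open BooleanAlgebra (freeBA n)
    using (setoid; ∧-congˡ; ∧-congʳ; ∨-congˡ; ∨-congʳ; ∧-distribˡ-∨; ∧-distribʳ-∨)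
  open BAProperties (freeBA n)
    using (∧-idem; ∧-identityˡ; ∧-identityʳ; ∧-zeroˡ; ∧-zeroʳ; ∨-identityˡ; ∨-identityʳ; ∨-idem)
  open SetoidReasoning setoid

  conj-· : ∀ {k} (f : Fin k → BExp n) i →
           conj (List.tabulate f) ·ᵇ f i ≡BA conj (List.tabulate f)
  conj-· f zero = begin
    (f zero ·ᵇ r) ·ᵇ f zero ≈⟨ ·ᵇ-comm _ _ ⟩
    f zero ·ᵇ (f zero ·ᵇ r) ≈⟨ ·ᵇ-assoc _ _ _ ⟨
    (f zero ·ᵇ f zero) ·ᵇ r ≈⟨ ∧-congʳ (∧-idem _) ⟩
    f zero ·ᵇ r             ∎
    where r = conj (List.tabulate (f ∘ suc))
  conj-· f (suc i) = ba-trans (·ᵇ-assoc _ _ _) (∧-congˡ (conj-· (f ∘ suc) i))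

  kill : ∀ {a b c : BExp n} → b ·ᵇ c ≡BA 𝟘 → a ·ᵇ b ≡BA a → a ·ᵇ c ≡BA 𝟘
  kill {a} {b} {c} bc ab = begin
    a ·ᵇ c        ≈⟨ ∧-congʳ ab ⟨
    (a ·ᵇ b) ·ᵇ c ≈⟨ ·ᵇ-assoc _ _ _ ⟩
    a ·ᵇ (b ·ᵇ c) ≈⟨ ∧-congˡ bc ⟩
    a ·ᵇ 𝟘        ≈⟨ ∧-zeroʳ a ⟩
    𝟘             ∎

  ⌜⌝-decides : ∀ (α : At n) b →
               ⌜ α ⌝ ·ᵇ b ≡BA (if eval α b then ⌜ α ⌝ else 𝟘)
  ⌜⌝-decides α 𝟘 = ∧-zeroʳ _
  ⌜⌝-decides α 𝟙 = ∧-identityʳ _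
  ⌜⌝-decides α (prim i)
    with lookup α i | conj-· (λ j → literal (lookup α j) j) i
  ... | true  | p = p
  ... | false | p = kill (ba-trans (·ᵇ-comm _ _) (·ᵇ-complement _)) p
  ⌜⌝-decides α (b ·ᵇ c) with eval α b | ⌜⌝-decides α b
  ... | true  | p = ba-trans (ba-sym (·ᵇ-assoc _ _ _)) (ba-trans (∧-congʳ p) (⌜⌝-decides α c))
  ... | false | p = ba-trans (ba-sym (·ᵇ-assoc _ _ _)) (ba-trans (∧-congʳ p) (∧-zeroˡ c))
  ⌜⌝-decides α (b +ᵇ c)
    with eval α b | eval α c | ⌜⌝-decides α b | ⌜⌝-decides α c
  ... | true  | true  | p | q = ba-trans (∧-distribˡ-∨ _ _ _) (ba-trans (+ᵇ-cong p q) (∨-idem _))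
  ... | true  | false | p | q = ba-trans (∧-distribˡ-∨ _ _ _) (ba-trans (+ᵇ-cong p q) (∨-identityʳ _))
  ... | false | true  | p | q = ba-trans (∧-distribˡ-∨ _ _ _) (ba-trans (+ᵇ-cong p q) (∨-identityˡ _))
  ... | false | false | p | q = ba-trans (∧-distribˡ-∨ _ _ _) (ba-trans (+ᵇ-cong p q) (∨-identityˡ _))
  ⌜⌝-decides α (b ᶜ) with eval α b | ⌜⌝-decides α b
  ... | true  | p = kill (·ᵇ-complement b) p
  ... | false | p = begin
    ⌜ α ⌝ ·ᵇ b ᶜ                ≈⟨ ∨-identityˡ _ ⟨
    𝟘 +ᵇ ⌜ α ⌝ ·ᵇ b ᶜ           ≈⟨ ∨-congʳ p ⟨
    ⌜ α ⌝ ·ᵇ b +ᵇ ⌜ α ⌝ ·ᵇ b ᶜ  ≈⟨ ∧-distribˡ-∨ _ _ _ ⟨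
    ⌜ α ⌝ ·ᵇ (b +ᵇ b ᶜ)         ≈⟨ ∧-congˡ (+ᵇ-complement b) ⟩
    ⌜ α ⌝ ·ᵇ 𝟙                  ≈⟨ ∧-identityʳ _ ⟩
    ⌜ α ⌝                       ∎

  ⌜⌝≢𝟘 : ∀ (α : At n) → ¬ (⌜ α ⌝ ≡BA 𝟘)
  ⌜⌝≢𝟘 α p with ≡.trans (≡.sym (eval-⌜⌝ α)) (eval-sound α p)
  ... | ()

  ≤⇒· : ∀ {b c : BExp n} → b ≤BA c → c ·ᵇ b ≡BA b
  ≤⇒· {b} {c} p = begin
    c ·ᵇ b        ≈⟨ ·ᵇ-comm _ _ ⟩
    b ·ᵇ c        ≈⟨ ∧-congˡ p ⟨
    b ·ᵇ (b +ᵇ c) ≈⟨ ·ᵇ-absorbs-+ᵇ b c ⟩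
    b             ∎

  ⌜⌝-isAtom : ∀ (α : At n) → IsAtom ⌜ α ⌝
  ⌜⌝-isAtom α = ⌜⌝≢𝟘 α , minimal
    where
    minimal : ∀ c → c ≤BA ⌜ α ⌝ → c ≡BA 𝟘 ⊎ c ≡BA ⌜ α ⌝
    minimal c p with eval α c | ⌜⌝-decides α c
    ... | true  | q = inj₂ (ba-trans (ba-sym (≤⇒· p)) q)
    ... | false | q = inj₁ (ba-trans (ba-sym (≤⇒· p)) q)

  disj : List (BExp n) → BExp n
  disj = foldr _+ᵇ_ 𝟘

  disj-++ : ∀ xs ys → disj (xs ++ ys) ≡BA disj xs +ᵇ disj ys
  disj-++ []       ys = ba-sym (∨-identityˡ _)
  disj-++ (x ∷ xs) ys = ba-trans (∨-congˡ (disj-++ xs ys)) (ba-sym (+ᵇ-assoc _ _ _))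

  disj-factor : ∀ {k} (l : BExp n) (f : At (suc k) → BExp n) (g : At k → BExp n) x →
                (∀ α → f (x ∷ α) ≡ l ·ᵇ g α) → ∀ αs →
                disj (List.map f (List.map (x ∷_) αs)) ≡BA l ·ᵇ disj (List.map g αs)
  disj-factor l f g x h []       = ba-sym (∧-zeroʳ l)
  disj-factor l f g x h (α ∷ αs) rewrite h α =
    ba-trans (∨-congˡ (disj-factor l f g x h αs)) (ba-sym (∧-distribˡ-∨ _ _ _))

  -- Generalised from `⌜_⌝` (the case f = id) to allow induction on k.
  minterm : ∀ {k} → (Fin k → Fin n) → At k → BExp n
  minterm f α = conj (List.tabulate λ i → literal (lookup α i) (f i))

  minterms-cover : ∀ k (f : Fin k → Fin n) →
                   disj (List.map (minterm f) (atoms k)) ≡BA 𝟙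
  minterms-cover zero    f = ∨-identityʳ 𝟙
  minterms-cover (suc k) f
    rewrite List.map-++ (minterm f) (List.map (true ∷_) (atoms k))
                                        (List.map (false ∷_) (atoms k)) = begin
    disj (ts ++ fs)               ≈⟨ disj-++ ts fs ⟩
    disj ts +ᵇ disj fs            ≈⟨ +ᵇ-cong (factor true) (factor false) ⟩
    t ·ᵇ r +ᵇ t ᶜ ·ᵇ r            ≈⟨ ∧-distribʳ-∨ _ _ _ ⟨
    (t +ᵇ t ᶜ) ·ᵇ r               ≈⟨ ·ᵇ-cong (+ᵇ-complement t) (minterms-cover k (f ∘ suc)) ⟩
    𝟙 ·ᵇ 𝟙                        ≈⟨ ∧-identityˡ 𝟙 ⟩
    𝟙                             ∎
    where

    t = prim (f zero)
    r = disj (List.map (minterm (f ∘ suc)) (atoms k))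
    ts = List.map (minterm f) (List.map (true ∷_) (atoms k))
    fs = List.map (minterm f) (List.map (false ∷_) (atoms k))
    factor : ∀ x → disj (List.map (minterm f) (List.map (x ∷_) (atoms k)))
                   ≡BA literal x (f zero) ·ᵇ r
    factor x = disj-factor _ (minterm f) (minterm (f ∘ suc)) x (λ _ → refl) (atoms k)

  isAtom⇒⌜⌝ : ∀ (b : BExp n) → IsAtom b → ∃ λ α → b ≡BA ⌜ α ⌝
  isAtom⇒⌜⌝ b (b≢0 , b-min) = [ id , (λ p → ⊥-elim (b≢0 (vanish p))) ] (search (atoms n))
    where
    search : ∀ αs → (∃ λ α → b ≡BA ⌜ α ⌝) ⊎ disj (List.map ⌜_⌝ αs) ·ᵇ b ≡BA 𝟘
    search []       = inj₂ (∧-zeroˡ b)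
    search (α ∷ αs) with eval α b | ⌜⌝-decides α b
    ... | true  | p = inj₁ (α , [ (λ q → ⊥-elim (⌜⌝≢𝟘 α q)) , ba-sym ] (b-min ⌜ α ⌝ below))
      where
      below : ⌜ α ⌝ +ᵇ b ≡BA b
      below = begin
        ⌜ α ⌝ +ᵇ b         ≈⟨ ∨-congʳ p ⟨
        ⌜ α ⌝ ·ᵇ b +ᵇ b    ≈⟨ +ᵇ-comm _ _ ⟩
        b +ᵇ ⌜ α ⌝ ·ᵇ b    ≈⟨ ∨-congˡ (·ᵇ-comm _ _) ⟩
        b +ᵇ b ·ᵇ ⌜ α ⌝    ≈⟨ +ᵇ-absorbs-·ᵇ _ _ ⟩
        b                  ∎
    ... | false | p = Sum.map₂
      (λ q → ba-trans (∧-distribʳ-∨ _ _ _) (ba-trans (+ᵇ-cong p q) (∨-identityˡ 𝟘)))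
      (search αs)

    vanish : disj (List.map ⌜_⌝ (atoms n)) ·ᵇ b ≡BA 𝟘 → b ≡BA 𝟘
    vanish p = begin
      b                                    ≈⟨ ∧-identityˡ b ⟨
      𝟙 ·ᵇ b                               ≈⟨ ∧-congʳ (minterms-cover n id) ⟨
      disj (List.map ⌜_⌝ (atoms n)) ·ᵇ b   ≈⟨ p ⟩
      𝟘                                    ∎

eval-conj⁻ : ∀ {n k} (α : At n) (f : Fin k → BExp n) →
             eval α (conj (List.tabulate f)) ≡ true → ∀ i → eval α (f i) ≡ true
eval-conj⁻ {k = suc k} α f h i with eval α (f zero) in eq
eval-conj⁻ {k = suc k} α f h zero    | true = eq
eval-conj⁻ {k = suc k} α f h (suc i) | true = eval-conj⁻ α (f ∘ suc) h i

literal-lookup : ∀ {n} (α : At n) x i → eval α (literal x i) ≡ true → lookup α i ≡ x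
literal-lookup α true  i p = p
literal-lookup α false i p with lookup α i
... | false = refl

⌜⌝-injective : ∀ {n} (α β : At n) → ⌜ α ⌝ ≡BA ⌜ β ⌝ → α ≡ β
⌜⌝-injective α β p = pointwise α β λ i → literal-lookup α (lookup β i) i
  (eval-conj⁻ α _ (≡.trans (≡.sym (eval-sound α p)) (eval-⌜⌝ α)) i)
  where
  pointwise : ∀ {k} (u v : Vec Bool k) → (∀ i → lookup u i ≡ lookup v i) → u ≡ v
  pointwise []      []      h = refl
  pointwise (x ∷ u) (y ∷ v) h = ≡.cong₂ _∷_ (h zero) (pointwise u v (h ∘ suc))

module GKAT {a : Level} (Act : Set a) (n : ℕ) where

  infixr 7 _·_
  infixr 6 _+[_]_
  infix  8 _^[_]
  infix  4 _≋_

  data Exp : Set a where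
    act    : Act → Exp
    test   : BExp n → Exp
    _·_    : Exp → Exp → Exp
    _+[_]_ : Exp → BExp n → Exp → Exp
    _^[_]  : Exp → BExp n → Exp

  E : Exp → BExp n
  E (act p)      = 𝟘
  E (test b)     = b
  E (e · f)      = E e ·ᵇ E f
  E (e +[ b ] f) = (b ·ᵇ E e) +ᵇ (b ᶜ ·ᵇ E f)
  E (e ^[ b ])   = b ᶜ

  data _≋_ : Exp → Exp → Set a where
    ≋-refl  : ∀ {e} → e ≋ e
    ≋-sym   : ∀ {e f} → e ≋ f → f ≋ e
    ≋-trans : ∀ {e f g} → e ≋ f → f ≋ g → e ≋ g

    -- Congruence, including in the Boolean arguments of the operators.
    ·-cong   : ∀ {e e′ f f′} → e ≋ e′ → f ≋ f′ → e · f ≋ e′ · f′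
    +-cong   : ∀ {e e′ b b′ f f′} → e ≋ e′ → test b ≋ test b′ → f ≋ f′ →
               e +[ b ] f ≋ e′ +[ b′ ] f′
    ^-cong   : ∀ {e e′ b b′} → e ≋ e′ → test b ≋ test b′ → e ^[ b ] ≋ e′ ^[ b′ ]
    +ᵇ-cong≋ : ∀ {b b′ c c′} → test b ≋ test b′ → test c ≋ test c′ →
               test (b +ᵇ c) ≋ test (b′ +ᵇ c′)
    ᶜ-cong≋  : ∀ {b b′} → test b ≋ test b′ → test (b ᶜ) ≋ test (b′ ᶜ)

    -- Boolean expressions are GKAT expressions, so for tests the product
    -- of `Exp` and that of `BExp` are one and the same operation.
    test-·  : ∀ b c → test (b ·ᵇ c) ≋ test b · test c
    test-BA : ∀ {b c} → b ≡BA c → test b ≋ test c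

    U1 : ∀ e b → e +[ b ] e ≋ e
    U2 : ∀ e f b → e +[ b ] f ≋ f +[ b ᶜ ] e
    U3 : ∀ e f g b c → (e +[ b ] f) +[ c ] g ≋ e +[ b ·ᵇ c ] (f +[ c ] g)
    U4 : ∀ e f b → e +[ b ] f ≋ (test b · e) +[ b ] f
    U5 : ∀ e f g b → (e · g) +[ b ] (f · g) ≋ (e +[ b ] f) · g

    S1 : ∀ e f g → (e · f) · g ≋ e · (f · g)
    S2 : ∀ e → test 𝟘 · e ≋ test 𝟘
    S3 : ∀ e → e · test 𝟘 ≋ test 𝟘
    S4 : ∀ e → test 𝟙 · e ≋ e
    S5 : ∀ e → e · test 𝟙 ≋ e

    W1 : ∀ e b → e ^[ b ] ≋ (e · e ^[ b ]) +[ b ] test 𝟙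
    W2 : ∀ e b c → (e +[ c ] test 𝟙) ^[ b ] ≋ (test c · e) ^[ b ]
    W3 : ∀ {e f g b} → g ≋ (e · g) +[ b ] f → test (E e) ≋ test 𝟘 → g ≋ e ^[ b ] · f

  -- The sum over Φ ⊆ At depends on the order in which elements of Φ are split
  -- off only up to _≋_; here that order is fixed by listing Φ.
  ⨁ : List (At n) → (At n → Exp) → Exp
  ⨁ Φ e = foldr (λ β r → e β +[ ⌜ β ⌝ ] r) (test 𝟘) Φ

  -- 2 + Act × X, where inj₁ false is 0 and inj₁ true is 1.
  Outcome : ∀ {ℓ} → Set ℓ → Set (a ⊔ ℓ)
  Outcome X = Bool ⊎ (Act × X)

  G : ∀ {ℓ} → Set ℓ → Set (a ⊔ ℓ)
  G X = At n → Outcome X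

  record Coalgebra (ℓ : Level) : Set (a ⊔ lsuc ℓ) where
    constructor ⟨_,_⟩
    field
      State : Set ℓ
      δ     : State → G State

  open Coalgebra public

  mapG : ∀ {ℓ ℓ′} {X : Set ℓ} {Y : Set ℓ′} → (X → Y) → G X → G Y
  mapG f t α = Sum.map₂ (map₂ f) (t α)

  _⊞_ : ∀ {ℓ} → Coalgebra ℓ → Coalgebra ℓ → Coalgebra ℓ
  𝒳 ⊞ 𝒴 = ⟨ State 𝒳 ⊎ State 𝒴 , [ mapG inj₁ ∘ δ 𝒳 , mapG inj₂ ∘ δ 𝒴 ] ⟩

  accepts : ∀ {ℓ} {X : Set ℓ} → Outcome X → Bool
  accepts = [ id , const false ]

  -- Uniform continuation; the subset Y is given by its characteristic function.
  _⟦_,_⟧ : ∀ {ℓ} (𝒳 : Coalgebra ℓ) → (State 𝒳 → Bool) → G (State 𝒳) → Coalgebra ℓ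
  𝒳 ⟦ Y , h ⟧ =
    ⟨ State 𝒳 , (λ x α → if Y x ∧ accepts (δ 𝒳 x α) then h α else δ 𝒳 x α) ⟩

  leftPart : ∀ {ℓ} {X Y : Set ℓ} → X ⊎ Y → Bool
  leftPart = [ const true , const false ]

  data WellNested {ℓ : Level} : Coalgebra ℓ → Set (a ⊔ lsuc ℓ) where
    no-transitions : ∀ {𝒳} →
      (∀ x α → ∃ λ (b : Bool) → δ 𝒳 x α ≡ inj₁ b) → WellNested 𝒳
    continuation : ∀ {𝒳 𝒴} → WellNested 𝒳 → WellNested 𝒴 →
      (h : G (State 𝒳 ⊎ State 𝒴)) → WellNested ((𝒳 ⊞ 𝒴) ⟦ leftPart , h ⟧)
    -- Structure maps are extensional functions: two coalgebras whose
    -- structure maps agree pointwise are the same coalgebra.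
    extensional : ∀ {X : Set ℓ} {d d′ : X → G X} →
      (∀ x α → d x α ≡ d′ x α) → WellNested ⟨ X , d ⟩ → WellNested ⟨ X , d′ ⟩

  ⌊_⌋ : ∀ {ℓ} {X : Set ℓ} → Outcome X → (X → Exp) → Exp
  ⌊ inj₁ false ⌋    s = test 𝟘
  ⌊ inj₁ true ⌋     s = test 𝟙
  ⌊ inj₂ (p , x) ⌋  s = act p · s x

  IsSolution : ∀ {ℓ} (𝒳 : Coalgebra ℓ) → (State 𝒳 → Exp) → Set (a ⊔ ℓ)
  IsSolution 𝒳 s = ∀ x → s x ≋ ⨁ (atoms n) (λ α → ⌊ δ 𝒳 x α ⌋ s)

{-# OPTIONS --safe #-}

-- For a continuation (𝒳 + 𝒴)[X, h] with solutions sX and sY, let b be the test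
-- "h α moves into X" and let k = e^(b) · f, where e collects the steps of h into
-- X (followed by sX) and f all other outcomes of h (followed by sY).  Then
-- x ↦ sX x · k, y ↦ sY y is a solution: wherever x accepts under α, unrolling
-- the loop once shows that α · k is α · ⌊h α⌋.
module Submission where

open import Defs
open import Algebra.Lattice.Bundles using (BooleanAlgebra)
import Algebra.Lattice.Properties.BooleanAlgebra as BAProperties
open import Data.Bool.Base using (Bool; true; false; if_then_else_)
open import Data.Bool.Properties using (∨-identityʳ)
open import Data.List.Base using ([]; _∷_)
open import Data.List.Membership.Propositional using (_∈_)
open import Data.List.Relation.Unary.Any using (here; there)
open import Data.Nat.Base using (ℕ; NonZero)
open import Data.Product.Base using (∃; _,_; map₂)
open import Data.Sum.Base using (_⊎_; inj₁; inj₂; [_,_])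
import Data.Sum.Base as Sum
open import Data.Vec.Base using (lookup)
open import Data.Vec.Properties using (tabulate∘lookup; tabulate-cong)
open import Function.Base using (_∘_; const)
open import Level using (Level)
open import Relation.Binary.Bundles using (Setoid)
open import Relation.Binary.PropositionalEquality as ≡ using (_≡_; refl)
import Relation.Binary.Reasoning.Setoid as SetoidReasoning

-- A conjunction true at α has all its literals true there, which fixes every entry of α.
eval-⌜⌝⁻ : ∀ {n} (α β : At n) → eval α ⌜ β ⌝ ≡ true → α ≡ β
eval-⌜⌝⁻ α β p = begin
  α                     ≡⟨ tabulate∘lookup α ⟨
  _                     ≡⟨ tabulate-cong (λ i → literal-lookup α (lookup β i) i (eval-conj⁻ α _ p i)) ⟩
  _                     ≡⟨ tabulate∘lookup β ⟩
  β                     ∎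
  where open ≡.≡-Reasoning

module Solving {a : Level} (Act : Set a) (n : ℕ) where

  open GKAT Act n
  open BooleanAlgebra (freeBA n) using (∧-complementˡ)
  open BAProperties (freeBA n) using (¬-involutive)

  ≋-setoid : Setoid a a
  ≋-setoid = record
    { Carrier = Exp
    ; _≈_ = _≋_
    ; isEquivalence = record { refl = ≋-refl ; sym = ≋-sym ; trans = ≋-trans }
    }

  open SetoidReasoning ≋-setoid

  -- Guarded choice and leading tests

  ·-congˡ : ∀ {e f g} → f ≋ g → e · f ≋ e · g
  ·-congˡ = ·-cong ≋-refl

  ·-congʳ : ∀ {e f g} → f ≋ g → f · e ≋ g · e
  ·-congʳ p = ·-cong p ≋-refl

  +-congˡ : ∀ {e b f g} → f ≋ g → e +[ b ] f ≋ e +[ b ] g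
  +-congˡ = +-cong ≋-refl ≋-refl

  +-congʳ : ∀ {e b f g} → f ≋ g → f +[ b ] e ≋ g +[ b ] e
  +-congʳ p = +-cong p ≋-refl ≋-refl

  +-congᵇ : ∀ {e b c f} → b ≡BA c → e +[ b ] f ≋ e +[ c ] f
  +-congᵇ p = +-cong ≋-refl (test-BA p) ≋-refl

  U2′ : ∀ e f b → e +[ b ᶜ ] f ≋ f +[ b ] e
  U2′ e f b = ≋-trans (U2 e f (b ᶜ)) (+-congᵇ (¬-involutive b))

  -- U4 puts the guard in front of the left branch, so agreement under the guard suffices.
  +-guardˡ : ∀ {e f g b} → test b · e ≋ test b · f → e +[ b ] g ≋ f +[ b ] g
  +-guardˡ {e} {f} {g} {b} p = begin
    e +[ b ] g            ≈⟨ U4 e g b ⟩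
    (test b · e) +[ b ] g ≈⟨ +-congʳ p ⟩
    (test b · f) +[ b ] g ≈⟨ U4 f g b ⟨
    f +[ b ] g            ∎

  +-guardʳ : ∀ {e f g b} → test (b ᶜ) · f ≋ test (b ᶜ) · g → e +[ b ] f ≋ e +[ b ] g
  +-guardʳ {e} {f} {g} {b} p = begin
    e +[ b ] f    ≈⟨ U2 e f b ⟩
    f +[ b ᶜ ] e  ≈⟨ +-guardˡ p ⟩
    g +[ b ᶜ ] e  ≈⟨ U2′ g e b ⟩
    e +[ b ] g    ∎

  +-𝟘ᵇ : ∀ e f → e +[ 𝟘 ] f ≋ f
  +-𝟘ᵇ e f = begin
    e +[ 𝟘 ] f  ≈⟨ +-guardˡ (≋-trans (S2 e) (≋-sym (S2 f))) ⟩
    f +[ 𝟘 ] f  ≈⟨ U1 f 𝟘 ⟩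
    f           ∎

  ᶜ-·-test : ∀ b → test (b ᶜ) · test b ≋ test 𝟘
  ᶜ-·-test b = ≋-trans (≋-sym (test-· (b ᶜ) b)) (test-BA (∧-complementˡ b))

  test-as-+ : ∀ b → test b ≋ test 𝟙 +[ b ] test 𝟘
  test-as-+ b = begin
    test b                  ≈⟨ U1 (test b) b ⟨
    test b +[ b ] test b    ≈⟨ +-congʳ (S5 (test b)) ⟨
    (test b · test 𝟙) +[ b ] test b ≈⟨ U4 (test 𝟙) (test b) b ⟨
    test 𝟙 +[ b ] test b    ≈⟨ +-guardʳ (≋-trans (ᶜ-·-test b) (≋-sym (S3 _))) ⟩
    test 𝟙 +[ b ] test 𝟘    ∎

  -- Turns a leading test into a guarded choice, the form to which U3 applies.
  test-·-as-+ : ∀ b e → test b · e ≋ e +[ b ] test 𝟘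
  test-·-as-+ b e = begin
    test b · e                          ≈⟨ ·-congʳ (test-as-+ b) ⟩
    (test 𝟙 +[ b ] test 𝟘) · e          ≈⟨ U5 (test 𝟙) (test 𝟘) e b ⟨
    (test 𝟙 · e) +[ b ] (test 𝟘 · e)    ≈⟨ +-cong (S4 e) ≋-refl (S2 e) ⟩
    e +[ b ] test 𝟘                     ∎

  test-·-+ : ∀ b c e f → test c · (e +[ b ] f) ≋ e +[ b ·ᵇ c ] (test c · f)
  test-·-+ b c e f = begin
    test c · (e +[ b ] f)            ≈⟨ test-·-as-+ c _ ⟩
    (e +[ b ] f) +[ c ] test 𝟘       ≈⟨ U3 e f (test 𝟘) b c ⟩
    e +[ b ·ᵇ c ] (f +[ c ] test 𝟘)  ≈⟨ +-congˡ (test-·-as-+ c f) ⟨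
    e +[ b ·ᵇ c ] (test c · f)       ∎

  -- An atom decides every test: U3 produces the guard `b ·ᵇ ⌜ α ⌝`, which is equivalent to `⌜ α ⌝`
  -- or to `𝟘`.
  atom-·-+ : ∀ α b e f →
             test ⌜ α ⌝ · (e +[ b ] f) ≋ test ⌜ α ⌝ · (if eval α b then e else f)
  atom-·-+ α b e f with eval α b | ba-trans (·ᵇ-comm b ⌜ α ⌝) (⌜⌝-decides α b)
  ... | true  | p = begin
    test c · (e +[ b ] f)       ≈⟨ test-·-+ b c e f ⟩
    e +[ b ·ᵇ c ] (test c · f)  ≈⟨ +-congᵇ p ⟩
    -- The right branch runs under the complement of `c`, where `test c · f` vanishes.
    e +[ c ] (test c · f)       ≈⟨ +-guardʳ vanish ⟩
    e +[ c ] test 𝟘             ≈⟨ test-·-as-+ c e ⟨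
    test c · e                  ∎
    where
    c = ⌜ α ⌝
    vanish : test (c ᶜ) · (test c · f) ≋ test (c ᶜ) · test 𝟘
    vanish = begin
      test (c ᶜ) · (test c · f)  ≈⟨ S1 _ _ _ ⟨
      (test (c ᶜ) · test c) · f  ≈⟨ ·-congʳ (ᶜ-·-test c) ⟩
      test 𝟘 · f                 ≈⟨ S2 f ⟩
      test 𝟘                     ≈⟨ S3 _ ⟨
      test (c ᶜ) · test 𝟘        ∎
  ... | false | p = begin
    test ⌜ α ⌝ · (e +[ b ] f)            ≈⟨ test-·-+ b ⌜ α ⌝ e f ⟩
    e +[ b ·ᵇ ⌜ α ⌝ ] (test ⌜ α ⌝ · f)   ≈⟨ +-congᵇ p ⟩
    e +[ 𝟘 ] (test ⌜ α ⌝ · f)            ≈⟨ +-𝟘ᵇ e _ ⟩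
    test ⌜ α ⌝ · f                       ∎

  -- Guarded sums over atoms

  ⨁-guard-cong : ∀ {e f : At n → Exp} Φ →
                 (∀ α → test ⌜ α ⌝ · e α ≋ test ⌜ α ⌝ · f α) → ⨁ Φ e ≋ ⨁ Φ f
  ⨁-guard-cong []      p = ≋-refl
  -- Each summand stands under its own atom as guard.
  ⨁-guard-cong (α ∷ Φ) p = ≋-trans (+-guardˡ (p α)) (+-congˡ (⨁-guard-cong Φ p))

  ⨁-cong : ∀ {e f : At n → Exp} Φ → (∀ α → e α ≋ f α) → ⨁ Φ e ≋ ⨁ Φ f
  ⨁-cong Φ p = ⨁-guard-cong Φ (·-congˡ ∘ p)

  ⨁-distribʳ : ∀ (e : At n → Exp) g Φ → ⨁ Φ e · g ≋ ⨁ Φ (λ α → e α · g)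
  ⨁-distribʳ e g []      = S2 g
  ⨁-distribʳ e g (α ∷ Φ) = ≋-trans (≋-sym (U5 _ _ g _)) (+-congˡ (⨁-distribʳ e g Φ))

  -- `⌜ β ⌝` holds at α only for β = α, so α passes over every other summand until it meets its own.
  ⨁-select : ∀ (e : At n → Exp) {α Φ} → α ∈ Φ → test ⌜ α ⌝ · ⨁ Φ e ≋ test ⌜ α ⌝ · e α
  ⨁-select e {α} {β ∷ Φ} α∈ with eval α ⌜ β ⌝ in eq | atom-·-+ α ⌜ β ⌝ (e β) (⨁ Φ e)
  ... | true | p with refl ← eval-⌜⌝⁻ α β eq = p
  ⨁-select e {α} (here refl) | false | p with () ← ≡.trans (≡.sym eq) (eval-⌜⌝ α)
  ⨁-select e (there α∈)      | false | p = ≋-trans p (⨁-select e α∈)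

  eval-E-⨁ : ∀ (e : At n → Exp) {α Φ} → α ∈ Φ → eval α (E (⨁ Φ e)) ≡ eval α (E (e α))
  eval-E-⨁ e {α} {β ∷ Φ} α∈ with eval α ⌜ β ⌝ in eq
  ... | true with refl ← eval-⌜⌝⁻ α β eq = ∨-identityʳ _
  eval-E-⨁ e {α} (here refl) | false with () ← ≡.trans (≡.sym eq) (eval-⌜⌝ α)
  eval-E-⨁ e (there α∈)      | false = eval-E-⨁ e α∈

  -- E reads a guarded sum as a case distinction on the atom, so it realises φ as a test.
  charTest : (At n → Bool) → BExp n
  charTest φ = E (⨁ (atoms n) (λ α → test (if φ α then 𝟙 else 𝟘)))

  eval-charTest : ∀ φ α → eval α (charTest φ) ≡ φ α
  eval-charTest φ α = ≡.trans (eval-E-⨁ _ (atoms-complete α)) indicator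
    where
    indicator : eval α (if φ α then 𝟙 else 𝟘) ≡ φ α
    indicator with φ α
    ... | true  = refl
    ... | false = refl

  ⌊⌋-map : ∀ {ℓ ℓ′} {X : Set ℓ} {Y : Set ℓ′} (f : X → Y) (s : Y → Exp) (o : Outcome X) →
           ⌊ o ⌋ (s ∘ f) ≡ ⌊ Sum.map₂ (map₂ f) o ⌋ s
  ⌊⌋-map f s (inj₁ false) = refl
  ⌊⌋-map f s (inj₁ true)  = refl
  ⌊⌋-map f s (inj₂ _)     = refl

  ^-unroll : ∀ e b f → e ^[ b ] · f ≋ (e · (e ^[ b ] · f)) +[ b ] f
  ^-unroll e b f = begin
    e ^[ b ] · f                             ≈⟨ ·-congʳ (W1 e b) ⟩
    ((e · e ^[ b ]) +[ b ] test 𝟙) · f       ≈⟨ U5 _ _ _ _ ⟨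
    ((e · e ^[ b ]) · f) +[ b ] (test 𝟙 · f) ≈⟨ +-cong (S1 _ _ _) ≋-refl (S4 f) ⟩
    (e · (e ^[ b ] · f)) +[ b ] f            ∎

  -- Solving a uniform continuation

  module Continuation {ℓ} {𝒳 𝒴 : Coalgebra ℓ} (h : G (State 𝒳 ⊎ State 𝒴))
    (sX : State 𝒳 → Exp) (solX : IsSolution 𝒳 sX)
    (sY : State 𝒴 → Exp) (solY : IsSolution 𝒴 sY) where

    intoX : At n → Bool
    intoX α = [ const false , (λ (_ , z) → leftPart z) ] (h α)

    -- The loop guard lets `body` act only at atoms where `h` moves into X, and `exit` only at the
    -- rest; `test 𝟘` fills the cases thereby excluded.
    body exit : At n → Exp
    body α = ⌊ h α ⌋ [ sX , const (test 𝟘) ]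
    exit α = ⌊ h α ⌋ [ const (test 𝟘) , sY ]

    -- Acceptance by `sX` ends one pass and returns to the loop guard, just as acceptance in X hands
    -- control back to `h`.
    k : Exp
    k = ⨁ (atoms n) body ^[ charTest intoX ] · ⨁ (atoms n) exit

    s : State 𝒳 ⊎ State 𝒴 → Exp
    s = [ (λ x → sX x · k) , sY ]

    atom-·-k : ∀ α → test ⌜ α ⌝ · k ≋ test ⌜ α ⌝ · (if intoX α then body α · k else exit α)
    atom-·-k α with intoX α | eval-charTest intoX α
                  | atom-·-+ α (charTest intoX) (⨁ (atoms n) body · k) (⨁ (atoms n) exit)
    -- By `eq` the loop guard holds at α, so the rewrite resolves the conditional in `p` to the
    -- looping branch.
    ... | true  | eq | p rewrite eq = begin
      test ⌜ α ⌝ · k                            ≈⟨ ·-congˡ (^-unroll _ _ _) ⟩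
      _                                         ≈⟨ p ⟩
      test ⌜ α ⌝ · (⨁ (atoms n) body · k)       ≈⟨ S1 _ _ _ ⟨
      (test ⌜ α ⌝ · ⨁ (atoms n) body) · k       ≈⟨ ·-congʳ (⨁-select body (atoms-complete α)) ⟩
      (test ⌜ α ⌝ · body α) · k                 ≈⟨ S1 _ _ _ ⟩
      test ⌜ α ⌝ · (body α · k)                 ∎
    ... | false | eq | p rewrite eq = begin
      test ⌜ α ⌝ · k                            ≈⟨ ·-congˡ (^-unroll _ _ _) ⟩
      _                                         ≈⟨ p ⟩
      test ⌜ α ⌝ · ⨁ (atoms n) exit             ≈⟨ ⨁-select exit (atoms-complete α) ⟩
      test ⌜ α ⌝ · exit α                       ∎

    atom-·-k≋⌊h⌋ : ∀ α → test ⌜ α ⌝ · k ≋ test ⌜ α ⌝ · ⌊ h α ⌋ s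
    atom-·-k≋⌊h⌋ α = ≋-trans (atom-·-k α) (·-congˡ step)
      where
      step : (if intoX α then body α · k else exit α) ≋ ⌊ h α ⌋ s
      step with h α
      ... | inj₁ false        = ≋-refl
      ... | inj₁ true         = ≋-refl
      -- `s (inj₁ x)` already ends in `k`, so only reassociation remains.
      ... | inj₂ (p , inj₁ x) = S1 _ _ _
      ... | inj₂ (p , inj₂ y) = ≋-refl

    s-isSolution : IsSolution ((𝒳 ⊞ 𝒴) ⟦ leftPart , h ⟧) s
    s-isSolution (inj₁ x) = begin
      sX x · k                                       ≈⟨ ·-congʳ (solX x) ⟩
      ⨁ (atoms n) (λ α → ⌊ δ 𝒳 x α ⌋ sX) · k         ≈⟨ ⨁-distribʳ _ k (atoms n) ⟩
      -- The summands are compared only under their atoms: an accepting one has become `k`, which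
      -- matches `⌊ h α ⌋ s` only after α.
      ⨁ (atoms n) (λ α → ⌊ δ 𝒳 x α ⌋ sX · k)         ≈⟨ ⨁-guard-cong (atoms n) outcome ⟩
      ⨁ (atoms n) (λ α → ⌊ δ ((𝒳 ⊞ 𝒴) ⟦ leftPart , h ⟧) (inj₁ x) α ⌋ s) ∎
      where
      outcome : ∀ α → test ⌜ α ⌝ · (⌊ δ 𝒳 x α ⌋ sX · k) ≋
                test ⌜ α ⌝ · ⌊ δ ((𝒳 ⊞ 𝒴) ⟦ leftPart , h ⟧) (inj₁ x) α ⌋ s
      outcome α with δ 𝒳 x α
      ... | inj₁ false = ·-congˡ (S2 k)
      ... | inj₁ true  = ≋-trans (·-congˡ (S4 k)) (atom-·-k≋⌊h⌋ α)
      ... | inj₂ _     = ·-congˡ (S1 _ _ _)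
    s-isSolution (inj₂ y) = ≋-trans (solY y)
      -- Outcomes of Y are left intact by the continuation; only their target states are tagged by
      -- `inj₂`.
      (⨁-cong (atoms n) λ α → Setoid.reflexive ≋-setoid (⌊⌋-map inj₂ s (δ 𝒴 y α)))

  -- Induction on well-nestedness

  solve : ∀ {ℓ} (𝒳 : Coalgebra ℓ) → WellNested 𝒳 → ∃ λ (s : State 𝒳 → Exp) → IsSolution 𝒳 s
  solve 𝒳 (no-transitions stuck) = s , λ x → ⨁-cong (atoms n) (outcome x)
    where
    s : State 𝒳 → Exp
    -- Without transitions `⌊_⌋` never consults its map, so a constant seed avoids defining `s`
    -- through itself.
    s x = ⨁ (atoms n) (λ α → ⌊ δ 𝒳 x α ⌋ (const (test 𝟘)))
    outcome : ∀ x α → ⌊ δ 𝒳 x α ⌋ (const (test 𝟘)) ≋ ⌊ δ 𝒳 x α ⌋ s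
    outcome x α with δ 𝒳 x α | stuck x α
    ... | _ | false , refl = ≋-refl
    ... | _ | true  , refl = ≋-refl
  solve _ (continuation {𝒳} {𝒴} wX wY h) with solve 𝒳 wX | solve 𝒴 wY
  ... | sX , solX | sY , solY = s , s-isSolution
    where open Continuation {𝒳 = 𝒳} {𝒴 = 𝒴} h sX solX sY solY
  solve _ (extensional d≗d′ w) with solve _ w
  ... | s , sol = s , λ x → ≋-trans (sol x) (⨁-cong (atoms n) λ α →
    Setoid.reflexive ≋-setoid (≡.cong (λ o → ⌊ o ⌋ s) (d≗d′ x α)))

theorem4p7 : ∀ {a ℓ : Level} (Act : Set a) (n : ℕ) .{{_ : NonZero n}} → Act →
    let open GKAT Act n in
    (𝒳 : Coalgebra ℓ) → WellNested 𝒳 → ∃ λ (s : State 𝒳 → Exp) → IsSolution 𝒳 s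
theorem4p7 Act n _ = Solving.solve Act n
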